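{- Let $\sigma$ be a finite or countable signature, $\psi$ a strictly limited complexity measure over $\sigma$ for which $K_\psi$ is a total recursive function, $C$ a nonempty class of structures of $\sigma$, and $H$ a nonempty subset of $H(\sigma)$. If the problem of solvability for the quadruple $(\mathrm{Probl}(\sigma),\mathrm{Tree}(\sigma),H,C)$ is decidable, then the problem of optimization for the triple $(\psi,H,C)$ is decidable.
   Context: Notation: $\omega=\{0,1,2,\dots\}$, $E_2=\{0,1\}$, variables $X=\{x_i:i\in\omega\}$, $X_n=\{x_0,\dots,x_{n-1}\}$; $\alpha^1=\alpha$, $\alpha^0=\neg\alpha$. The signature $\sigma$ (predicate and function symbols with arities, containing predicate symbols) is written $\{q_0,\dots,q_m\}$ or $\{q_0,q_1,\dots\}$; $\sigma^*$ is the set of finite words over $\sigma$ including the empty word $\lambda$. A complexity measure is $\psi:\sigma^*\to\omega$; it is strictly limited if computable and $\psi(\alpha_1\alpha_2\alpha_3)>\psi(\alpha_1\alpha_3)$ whenever $\alpha_2\ne\lambda$. For $i\in\omega$, $\omega_\psi(i)=\{q_j\in\sigma:\psi(q_j)=i\}$; $K_\psi$ is the partial function $\omega\to\omega$ with $K_\psi(i)=|\omega_\psi(i)|$ if this set is finite and undefined otherwise. A function expression is $x_j\Leftarrow f(x_{l_1},\dots,x_{l_m})$ ($f$ an $m$-ary function symbol); an (equality-free) predicate expression is $r(x_{l_1},\dots,x_{l_k})$ ($r$ a $k$-ary predicate symbol). For $n\ge1$ and a sequence $\beta=\beta_1,\dots,\beta_m$ define term sequences $M_i=(t_{i0},t_{i1},\dots)$: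 $M_1=(x_0,\dots,x_{n-1},x_{n-1},\dots)$; $M_{i+1}=M_i$ if $\beta_i$ is a predicate expression; if $\beta_i$ is $x_j\Leftarrow f(x_{l_1},\dots,x_{l_m})$, $M_{i+1}$ is $M_i$ with $t_{ij}$ replaced by $f(t_{il_1},\dots,t_{il_m})$. For predicate $\beta_i=r(x_{l_1},\dots,x_{l_k})$, $\kappa(n,\beta,\beta_i)=r(t_{il_1},\dots,t_{il_k})$. $\mathrm{word}(\beta)=q_{i_1}\cdots q_{i_m}$ where $q_{i_j}$ is the symbol in $\beta_j$. $\mathrm{Tree}(\sigma)$: schemes $S=(n,G)$, $n\ge1$, $G$ a finite rooted directed tree with function nodes (function expression, one outgoing edge), predicate nodes (equality-free predicate expression, two outgoing edges labeled $0,1$), terminal nodes (labeled by numbers in $\omega$). For a complete path $\tau=w_1,d_1,\dots,w_m,d_m,w_{m+1}$ with expressions $\beta_\tau=\beta_1,\dots,\beta_m$, $F(\tau)$ is the set of $\kappa(n,\beta_\tau,\beta_i)^c$ for predicate nodes $w_i$, $c$ the label of $d_i$ (a tautology if none), $t_\tau$ the terminal label. For a structure $U$ with universe $A$, $\varphi_{(S,U)}(\bar a)=t_\tau$ for the unique complete path $\tau$ with all of $F(\tau)$ true in $U$ on $\bar a\in A^n$. $\psi(S)=\max_\tau\psi(\mathrm{word}(\beta_\tau))$ over complete paths. $\mathrm{Probl}(\sigma)$: schemes $s=(n,\nu,\beta_1,\dots,\beta_m)$, $n,m\ge1$, equality-free expressions with exactly $k\ge1$ predicate expressions $\beta_{i_1},\dots,\beta_{i_k}$,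 $\nu:E_2^k\to\omega$; with $\alpha_j=\kappa(n,\beta,\beta_{i_j})$, $\varphi_{(s,U)}(\bar a)=\nu(\alpha_1(\bar a),\dots,\alpha_k(\bar a))$. $S=(n_1,G)$ solves $s=(n_2,\dots)$ relative to class $C$ if $n_1=n_2$ and either $C=\emptyset$ or $\varphi_{(S,U)}=\varphi_{(s,U)}$ for all $U\in C$. $H(\sigma)$: equality-free sentences of $\sigma$; $C(\alpha)=\{U\in C:U\models\alpha\}$. Problem of solvability for $(\mathrm{Probl}(\sigma),\mathrm{Tree}(\sigma),H,C)$: given $\alpha\in H$, $s\in\mathrm{Probl}(\sigma)$, $S\in\mathrm{Tree}(\sigma)$, decide whether $S$ solves $s$ relative to $C(\alpha)$. Problem of optimization for $(\psi,H,C)$: given $\alpha\in H$ and $s\in\mathrm{Probl}(\sigma)$, find $S\in\mathrm{Tree}(\sigma)$ that solves $s$ relative to $C(\alpha)$ and has minimum $\psi(S)$ among such schemes. A problem is decidable if an algorithm solves it. -}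

module Defs where

open import Data.Nat using (ℕ; zero; suc; _≤_; _<_; _⊔_; _⊓_; _∸_; _≡ᵇ_; _<?_)
open import Data.Fin using (Fin; fromℕ<; cast)
open import Data.Bool using (Bool; true; false; if_then_else_; _∨_)
open import Data.Vec using (Vec; []; _∷_)
import Data.Vec as V
open import Data.List using (List; []; _∷_; _++_; foldr)
import Data.List as L
open import Data.Product using (Σ; _×_; _,_)
open import Data.Sum using (_⊎_)
open import Function using (_∘_)
open import Function.Bundles using (_↔_)
open import Relation.Binary.PropositionalEquality using (_≡_; _≢_; sym)
open import Relation.Nullary using (¬_; Dec; yes; no)

data Kind : Set where
  func pred : Kind

data SigSize : Set where
  finite    : ℕ → SigSize
  countable : SigSize

Idx : SigSize → Set
Idx (finite m) = Fin m
Idx countable  = ℕ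

record Signature : Set where
  field
    size    : SigSize
    kind    : Idx size → Kind
    arity   : Idx size → ℕ
    hasPred : Σ (Idx size) (λ q → kind q ≡ pred)
  Sym : Set
  Sym = Idx size

module _ (σ : Signature) where
  open Signature σ

  Word : Set
  Word = List Sym

  -- strictly limited complexity measure (computability is automatic in Agda)
  StrictlyLimited : (Word → ℕ) → Set
  StrictlyLimited ψ = ∀ (a₁ a₂ a₃ : Word) → a₂ ≢ [] → ψ (a₁ ++ a₃) < ψ (a₁ ++ a₂ ++ a₃)

  ωψ : (Word → ℕ) → ℕ → Set
  ωψ ψ i = Σ Sym (λ q → ψ (q ∷ []) ≡ i)

  KTotalRecursive : (Word → ℕ) → Set
  KTotalRecursive ψ = Σ (ℕ → ℕ) (λ K → ∀ i → Fin (K i) ↔ ωψ ψ i)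

  data Term : Set where
    var : ℕ → Term
    app : (f : Sym) → kind f ≡ func → Vec Term (arity f) → Term

  data Formula : Set where
    atom  : (r : Sym) → kind r ≡ pred → Vec Term (arity r) → Formula
    neg   : Formula → Formula
    conj  : Formula → Formula → Formula
    disj  : Formula → Formula → Formula
    impl  : Formula → Formula → Formula
    all   : ℕ → Formula → Formula
    ex    : ℕ → Formula → Formula

  mutual
    occT : ℕ → Term → Bool
    occT x (var y)      = x ≡ᵇ y
    occT x (app f p ts) = occTs x ts

    occTs : ∀ {k} → ℕ → Vec Term k → Bool
    occTs x []       = false
    occTs x (t ∷ ts) = occT x t ∨ occTs x ts

  freeIn : ℕ → Formula → Bool
  freeIn x (atom r p ts) = occTs x ts
  freeIn x (neg φ)       = freeIn x φ
  freeIn x (conj φ χ)    = freeIn x φ ∨ freeIn x χ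
  freeIn x (disj φ χ)    = freeIn x φ ∨ freeIn x χ
  freeIn x (impl φ χ)    = freeIn x φ ∨ freeIn x χ
  freeIn x (all y φ)     = if x ≡ᵇ y then false else freeIn x φ
  freeIn x (ex y φ)      = if x ≡ᵇ y then false else freeIn x φ

  Sentence : Formula → Set
  Sentence φ = ∀ x → freeIn x φ ≡ false

  record Structure : Set₁ where
    field
      A   : Set
      a₀  : A
      fun : (f : Sym) → kind f ≡ func → Vec A (arity f) → A
      rel : (r : Sym) → kind r ≡ pred → Vec A (arity r) → Bool

  module _ (U : Structure) where
    open Structure U

    mutual
      evalT : (ℕ → A) → Term → A
      evalT v (var x)      = v x
      evalT v (app f p ts) = fun f p (evalTs v ts)

      evalTs : ∀ {k} → (ℕ → A) → Vec Term k → Vec A k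
      evalTs v []       = []
      evalTs v (t ∷ ts) = evalT v t ∷ evalTs v ts

    update : (ℕ → A) → ℕ → A → ℕ → A
    update v x a y = if y ≡ᵇ x then a else v y

    Sat : (ℕ → A) → Formula → Set
    Sat v (atom r p ts) = rel r p (evalTs v ts) ≡ true
    Sat v (neg φ)       = ¬ Sat v φ
    Sat v (conj φ χ)    = Sat v φ × Sat v χ
    Sat v (disj φ χ)    = Sat v φ ⊎ Sat v χ
    Sat v (impl φ χ)    = Sat v φ → Sat v χ
    Sat v (all x φ)     = (a : A) → Sat (update v x a) φ
    Sat v (ex x φ)      = Σ A (λ a → Sat (update v x a) φ)

  -- U ⊨ α (for sentences the assignment is irrelevant)
  _⊨_ : Structure → Formula → Set
  U ⊨ α = Sat U (λ _ → Structure.a₀ U) α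

  Class : Set₂
  Class = Structure → Set₁

  _⟨_⟩ : Class → Formula → Class
  (C ⟨ α ⟩) U = C U × (U ⊨ α)

  record FExpr : Set where      -- x_j ⇐ f(x_{l_1},…,x_{l_m})
    field
      j    : ℕ
      f    : Sym
      isF  : kind f ≡ func
      args : Vec ℕ (arity f)

  record PExpr : Set where
    field
      r    : Sym
      isP  : kind r ≡ pred
      args : Vec ℕ (arity r)

  data Expr : Set where
    fe : FExpr → Expr
    pe : PExpr → Expr

  symOf : Expr → Sym
  symOf (fe e) = FExpr.f e
  symOf (pe e) = PExpr.r e

  TermSeq : Set
  TermSeq = ℕ → Term

  M₁ : ℕ → TermSeq
  M₁ n j = var (j ⊓ (n ∸ 1))

  stepF : TermSeq → FExpr → TermSeq
  stepF M e i = if i ≡ᵇ FExpr.j e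
                then app (FExpr.f e) (FExpr.isF e) (V.map M (FExpr.args e))
                else M i

  step : TermSeq → Expr → TermSeq
  step M (fe e) = stepF M e
  step M (pe e) = M

  κ : TermSeq → PExpr → Formula
  κ M e = atom (PExpr.r e) (PExpr.isP e) (V.map M (PExpr.args e))

  atomVal : (U : Structure) → (ℕ → Structure.A U) → Formula → Bool
  atomVal U v (atom r p ts) = Structure.rel U r p (evalTs U v ts)
  atomVal U v _             = false

  -- assignment x_i ↦ a_i for i < n (other variables never occur)
  env : (U : Structure) (n : ℕ) → (Fin n → Structure.A U) → ℕ → Structure.A U
  env U n ā i with i <? n
  ... | yes p = ā (fromℕ< p)
  ... | no _  = Structure.a₀ U

  data Tree : Set where
    leaf  : ℕ → Tree
    fnode : FExpr → Tree → Tree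
    pnode : PExpr → Tree → Tree → Tree     -- predicate node; edges labelled 0, 1

  record TreeScheme : Set where
    field
      n   : ℕ
      n≥1 : 1 ≤ n
      G   : Tree

  runTree : (U : Structure) → (ℕ → Structure.A U) → TermSeq → Tree → ℕ
  runTree U v M (leaf t)        = t
  runTree U v M (fnode e G)     = runTree U v (stepF M e) G
  runTree U v M (pnode e G₀ G₁) =
    if atomVal U v (κ M e) then runTree U v M G₁ else runTree U v M G₀

  φT : (S : TreeScheme) (U : Structure) → (Fin (TreeScheme.n S) → Structure.A U) → ℕ
  φT S U ā = runTree U (env U n ā) (M₁ n) G
    where open TreeScheme S

  pathWords : Tree → List Word
  pathWords (leaf t)        = [] ∷ []
  pathWords (fnode e G)     = L.map (FExpr.f e ∷_) (pathWords G)
  pathWords (pnode e G₀ G₁) = L.map (PExpr.r e ∷_) (pathWords G₀ ++ pathWords G₁)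

  ψT : (Word → ℕ) → TreeScheme → ℕ
  ψT ψ S = foldr _⊔_ 0 (L.map ψ (pathWords (TreeScheme.G S)))

  npred : List Expr → ℕ
  npred []          = 0
  npred (fe _ ∷ es) = npred es
  npred (pe _ ∷ es) = suc (npred es)

  record ProblemScheme : Set where
    field
      n     : ℕ
      n≥1   : 1 ≤ n
      exprs : List Expr
      k≥1   : 1 ≤ npred exprs
      ν     : Vec Bool (npred exprs) → ℕ  -- ν : E_2^k → ω  (true = 1)

  evalExprs : (U : Structure) → (ℕ → Structure.A U) → TermSeq →
              (es : List Expr) → Vec Bool (npred es)
  evalExprs U v M []          = []
  evalExprs U v M (fe e ∷ es) = evalExprs U v (stepF M e) es
  evalExprs U v M (pe e ∷ es) = atomVal U v (κ M e) ∷ evalExprs U v M es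

  φP : (s : ProblemScheme) (U : Structure) → (Fin (ProblemScheme.n s) → Structure.A U) → ℕ
  φP s U ā = ν (evalExprs U (env U n ā) (M₁ n) exprs)
    where open ProblemScheme s

  Solves : Class → TreeScheme → ProblemScheme → Set₁
  Solves D S s =
    Σ (TreeScheme.n S ≡ ProblemScheme.n s) λ eq →
      (¬ Σ Structure D)
      ⊎ (∀ U → D U → ∀ (ā : Fin (TreeScheme.n S) → Structure.A U) →
            φT S U ā ≡ φP s U (ā ∘ cast (sym eq)))

  SolvabilityDecidable : (Formula → Set) → Class → Set₁
  SolvabilityDecidable H C =
    (α : Formula) → H α → (s : ProblemScheme) → (S : TreeScheme) → Dec (Solves (C ⟨ α ⟩) S s)

  OptimizationDecidable : (Word → ℕ) → (Formula → Set) → Class → Set₁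
  OptimizationDecidable ψ H C =
    (α : Formula) → H α → (s : ProblemScheme) →
    Σ TreeScheme λ S → Solves (C ⟨ α ⟩) S s ×
      (∀ S′ → Solves (C ⟨ α ⟩) S′ s → ψT ψ S ≤ ψT ψ S′)

-- The decision tree that queries the predicate expressions of s one after another solves s;
-- let b be its complexity.  By strict limitation ψ strictly decreases from a tree to its
-- subtrees, so a tree of complexity at most b has depth at most b and uses only the finitely
-- many symbols q with ψ(q) ≤ b, which K_ψ enumerates.  Renaming its variables injectively into
-- an initial segment and mapping its leaf labels into the finite range of ν changes neither its
-- complexity nor whether it solves s, and puts it into an explicit finite list of trees.
-- Deciding solvability for every member of that list and taking one of least complexity
-- therefore yields an optimal scheme.
module Submission where

open import Defs
open import Data.Nat using (ℕ)
open import Data.Product using (Σ)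

open import Level using (Level)
open import Data.Bool using (Bool; true; false; if_then_else_)
open import Data.Bool.Properties using (if-float)
open import Data.Fin using (Fin; fromℕ<)
open import Data.Fin.Properties using (cast-is-id)
open import Data.List
  using (List; []; _∷_; _++_; [_]; foldr; length; concatMap; cartesianProductWith; upTo; allFin; filter)
import Data.List as L
open import Data.List.Properties using (length-++; map-++; ++-identityʳ)
open import Data.List.Extrema.Nat using (argmin; argmin-all; f[argmin]≤f[⊤]; f[argmin]≤f[xs])
open import Data.List.Membership.Propositional using (_∈_; lose)
open import Data.List.Membership.Propositional.Properties
  using ( ∈-map⁺; ∈-map⁻; ∈-++⁺ˡ; ∈-++⁺ʳ; ∈-concatMap⁺; ∈-cartesianProductWith⁺; ∈-upTo⁺; ∈-allFin
        ; ∈-filter⁺; foldr-selective)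
open import Data.List.Relation.Binary.Subset.Propositional using (_⊆_)
open import Data.List.Relation.Unary.All using (All; []; _∷_)
import Data.List.Relation.Unary.All as All
import Data.List.Relation.Unary.All.Properties as All
open import Data.List.Relation.Unary.All.Properties using (++⁺; ++⁻ˡ; ++⁻ʳ; all-filter)
open import Data.List.Relation.Unary.Any using (here; there)
open import Data.Nat
  using (zero; suc; _+_; _*_; _^_; _≤_; _<_; _⊔_; _⊓_; _∸_; _≡ᵇ_; _<?_; _≤?_; z≤n; s≤s)
open import Data.Nat.Properties
  using ( _≟_; ≤-refl; ≤-reflexive; ≤-trans; <⇒≤; ≤-<-trans; <-≤-trans; ≰⇒>; ≮⇒≥; m≤n⇒m≤1+n
        ; suc-injective; 0≢1+n; +-identityʳ; +-suc; m≤m+n; m+n≮m; +-cancelˡ-≡; +-mono-≤; +-monoʳ-≤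
        ; +-monoʳ-<; *-monoˡ-≤; m^n>0; ^-monoʳ-≤; m≤m⊔n; m≤n⊔m; ⊔-sel; ⊔-lub; m⊔n≤o⇒m≤o; m⊔n≤o⇒n≤o
        ; m≥n⇒m⊓n≡n; module ≤-Reasoning)
open import Data.List.Membership.DecPropositional _≟_ using (_∈?_)
open import Data.Product using (∃; _×_; _,_; proj₁; proj₂)
open import Data.Sum using (inj₁; inj₂)
open import Data.Vec using (Vec; []; _∷_)
import Data.Vec as V
open import Data.Vec.Properties using (toList-map; map-∘; length-toList)
open import Function using (_∘_; mk⇔)
open import Function.Bundles using (Inverse)
open import Relation.Binary.PropositionalEquality
  using (_≡_; _≗_; refl; sym; trans; cong; cong₂; subst; module ≡-Reasoning)
open import Relation.Nullary using (yes; no; contradiction)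
open import Relation.Nullary.Decidable using (does-⇔)
open import Relation.Unary using (Decidable)

module _ {a p : Level} {A : Set a} (P : A → Set p) (P? : Decidable P) (cost : A → ℕ) where
module _ {a p : Level} {A : Set a} (P : A → Set p) (P? : Decidable P) (cost : A → ℕ) where

  optimum-from-candidates : (x₀ : A) → P x₀ → (xs : List A) →
    (∀ x → P x → cost x ≤ cost x₀ → ∃ λ y → y ∈ xs × P y × cost y ≤ cost x) →
    Σ A λ x → P x × (∀ y → P y → cost x ≤ cost y)
  optimum-from-candidates x₀ px₀ xs dominated =
    best , argmin-all cost px₀ (all-filter P? xs) , optimal
    where
    solutions : List A
    solutions = filter P? xs

    best : A
    best = argmin cost x₀ solutions

    optimal : ∀ y → P y → cost best ≤ cost y
    optimal y py with cost y ≤? cost x₀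
    ... | no y≰x₀ = ≤-trans (f[argmin]≤f[⊤] {f = cost} x₀ solutions) (<⇒≤ (≰⇒> y≰x₀))
    ... | yes y≤x₀ with z , z∈xs , pz , z≤y ← dominated y py y≤x₀ =
      ≤-trans (All.lookup (f[argmin]≤f[xs] {f = cost} x₀ solutions) (∈-filter⁺ P? z∈xs pz)) z≤y

module _ {a : Level} {A : Set a} where

  maxBy : (A → ℕ) → List A → ℕ
  maxBy f xs = foldr _⊔_ 0 (L.map f xs)

  ≤-maxBy : ∀ (f : A → ℕ) {x xs} → x ∈ xs → f x ≤ maxBy f xs
  ≤-maxBy f {xs = x ∷ xs} (here refl) = m≤m⊔n (f x) _
  ≤-maxBy f {xs = y ∷ xs} (there x∈) = ≤-trans (≤-maxBy f x∈) (m≤n⊔m (f y) _)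

  maxBy-attained : ∀ (f : A → ℕ) {x₀ xs} → x₀ ∈ xs →
    ∃ λ x → x ∈ xs × maxBy f xs ≤ f x
  maxBy-attained f {x₀} {xs} x₀∈ with foldr-selective ⊔-sel 0 (L.map f xs)
  ... | inj₁ max≡0 = x₀ , x₀∈ , ≤-trans (≤-reflexive max≡0) z≤n
  ... | inj₂ max∈ with x , x∈ , max≡fx ← ∈-map⁻ f max∈ = x , x∈ , ≤-reflexive max≡fx

  length-concatMap≤ : ∀ {b} {B : Set b} (f : A → List B) {c xs} →
    All (λ x → length (f x) ≤ c) xs → length (concatMap f xs) ≤ length xs * c
  length-concatMap≤ f [] = z≤n
  length-concatMap≤ f {xs = x ∷ xs} (fx≤c ∷ fxs≤c) = begin
    length (f x ++ concatMap f xs)          ≡⟨ length-++ (f x) ⟩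
    length (f x) + length (concatMap f xs)  ≤⟨ +-mono-≤ fx≤c (length-concatMap≤ f fxs≤c) ⟩
    _ + length xs * _                       ∎
    where open ≤-Reasoning

  vectors : List A → (k : ℕ) → List (Vec A k)
  vectors xs zero = [ [] ]
  vectors xs (suc k) = cartesianProductWith _∷_ xs (vectors xs k)

  ∈-vectors⁺ : ∀ {xs k} {v : Vec A k} → All (_∈ xs) (V.toList v) → v ∈ vectors xs k
  ∈-vectors⁺ {v = []} [] = here refl
  ∈-vectors⁺ {v = x ∷ v} (x∈ ∷ v⊆) = ∈-cartesianProductWith⁺ _∷_ x∈ (∈-vectors⁺ v⊆)

module _ {a b : Level} {A : Set a} {B : Set b} where

  InjectiveOn : (A → B) → List A → Set (a Level.⊔ b)
  InjectiveOn f xs = ∀ {x y} → x ∈ xs → y ∈ xs → f x ≡ f y → x ≡ y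

  AgreeOn : List A → (A → B) → (A → B) → Set (a Level.⊔ b)
  AgreeOn xs f g = ∀ {x} → x ∈ xs → f x ≡ g x

  map-agreeOn : ∀ {xs} {f g : A → B} {k} (v : Vec A k) →
    AgreeOn xs f g → V.toList v ⊆ xs → V.map f v ≡ V.map g v
  map-agreeOn [] f≈g v⊆ = refl
  map-agreeOn (x ∷ v) f≈g v⊆ =
    cong₂ _∷_ (f≈g (v⊆ (here refl))) (map-agreeOn v f≈g (v⊆ ∘ there))

position : ℕ → List ℕ → ℕ
position i [] = 0
position i (x ∷ xs) with i ≟ x
... | yes _ = 0
... | no _ = suc (position i xs)

position< : ∀ {i xs} → i ∈ xs → position i xs < length xs
position< {i} {x ∷ xs} i∈ with i ≟ x | i∈
... | yes _ | _ = s≤s z≤n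
... | no i≢x | here i≡x = contradiction i≡x i≢x
... | no _ | there i∈xs = s≤s (position< i∈xs)

position-injective : ∀ xs → InjectiveOn (λ i → position i xs) xs
position-injective (x ∷ xs) {i} {j} i∈ j∈ eq with i ≟ x | j ≟ x | i∈ | j∈
... | yes i≡x | yes j≡x | _ | _ = trans i≡x (sym j≡x)
... | no i≢x | _ | here i≡x | _ = contradiction i≡x i≢x
... | _ | no j≢x | _ | here j≡x = contradiction j≡x j≢x
... | yes _ | no _ | _ | there _ = contradiction eq 0≢1+n
... | no _ | yes _ | there _ | _ = contradiction (sym eq) 0≢1+n
... | no _ | no _ | there i∈xs | there j∈xs =
  position-injective xs i∈xs j∈xs (suc-injective eq)

packAbove : ℕ → List ℕ → ℕ → ℕ
packAbove m xs i with i <? m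
... | yes _ = i
... | no _ = m + position i xs

packAbove-⊓ : ∀ m xs i → packAbove m xs i ⊓ m ≡ i ⊓ m
packAbove-⊓ m xs i with i <? m
... | yes _ = refl
... | no i≮m = trans (m≥n⇒m⊓n≡n (m≤m+n m _)) (sym (m≥n⇒m⊓n≡n (≮⇒≥ i≮m)))

packAbove-< : ∀ m {xs i} → i ∈ xs → packAbove m xs i < m + length xs
packAbove-< m {xs} {i} i∈ with i <? m
... | yes i<m = <-≤-trans i<m (m≤m+n m _)
... | no _ = +-monoʳ-< m (position< i∈)

packAbove-injective : ∀ m xs → InjectiveOn (packAbove m xs) xs
packAbove-injective m xs {i} {j} i∈ j∈ eq with i <? m | j <? m
... | yes _ | yes _ = eq
... | yes i<m | no _ = contradiction (subst (_< m) eq i<m) (m+n≮m m _)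
... | no _ | yes j<m = contradiction (subst (_< m) (sym eq) j<m) (m+n≮m m _)
... | no _ | no _ = position-injective xs i∈ j∈ (+-cancelˡ-≡ m _ _ eq)

retract : List ℕ → ℕ → ℕ → ℕ
retract xs d t with t ∈? xs
... | yes _ = t
... | no _ = d

retract-∈ : ∀ {xs d} → d ∈ xs → ∀ t → retract xs d t ∈ xs
retract-∈ {xs} d∈ t with t ∈? xs
... | yes t∈ = t∈
... | no _ = d∈

retract-id : ∀ {xs d t} → t ∈ xs → retract xs d t ≡ t
retract-id {xs} {t = t} t∈ with t ∈? xs
... | yes _ = refl
... | no t∉ = contradiction t∈ t∉

module Schemes (σ : Signature) where
  open Signature σ

  indices : Expr σ → List ℕ
  indices (fe e) = FExpr.j e ∷ V.toList (FExpr.args e)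
  indices (pe e) = V.toList (PExpr.args e)

  length-indices : ∀ x → length (indices x) ≤ suc (arity (symOf σ x))
  length-indices (fe e) = s≤s (≤-reflexive (length-toList (FExpr.args e)))
  length-indices (pe e) = m≤n⇒m≤1+n (≤-reflexive (length-toList (PExpr.args e)))

  nodes : Tree σ → List (Expr σ)
  nodes (leaf _) = []
  nodes (fnode e G) = fe e ∷ nodes G
  nodes (pnode e G₀ G₁) = pe e ∷ nodes G₀ ++ nodes G₁

  leaves : Tree σ → List ℕ
  leaves (leaf t) = [ t ]
  leaves (fnode _ G) = leaves G
  leaves (pnode _ G₀ G₁) = leaves G₀ ++ leaves G₁

  depth : Tree σ → ℕ
  depth (leaf _) = 0
  depth (fnode _ G) = suc (depth G)
  depth (pnode _ G₀ G₁) = suc (depth G₀ ⊔ depth G₁)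

  vars : Tree σ → List ℕ
  vars G = concatMap indices (nodes G)

  indices⊆vars : ∀ G → All (λ x → indices x ⊆ vars G) (nodes G)
  indices⊆vars G = All.tabulate λ x∈ i∈ → ∈-concatMap⁺ indices (lose x∈ i∈)

  2^d+2^d≡2^[1+d] : ∀ d → 2 ^ d + 2 ^ d ≡ 2 ^ suc d
  2^d+2^d≡2^[1+d] d = cong (2 ^ d +_) (sym (+-identityʳ _))

  length-nodes : ∀ G → length (nodes G) < 2 ^ depth G
  length-nodes (leaf _) = s≤s z≤n
  length-nodes (fnode _ G) = begin-strict
    suc (length (nodes G))       <⟨ +-mono-≤ (m^n>0 2 (depth G)) (length-nodes G) ⟩
    2 ^ depth G + 2 ^ depth G    ≡⟨ 2^d+2^d≡2^[1+d] (depth G) ⟩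
    2 ^ suc (depth G)            ∎
    where open ≤-Reasoning
  length-nodes (pnode _ G₀ G₁) = begin-strict
    suc (length (nodes G₀ ++ nodes G₁))                ≡⟨ cong suc (length-++ (nodes G₀)) ⟩
    suc (length (nodes G₀) + length (nodes G₁))        <⟨ s≤s (≤-reflexive (sym (+-suc _ _))) ⟩
    suc (length (nodes G₀)) + suc (length (nodes G₁))  ≤⟨ +-mono-≤ (below G₀ (m≤m⊔n _ _))
                                                                    (below G₁ (m≤n⊔m _ _)) ⟩
    2 ^ d + 2 ^ d                                      ≡⟨ 2^d+2^d≡2^[1+d] d ⟩
    2 ^ suc d                                          ∎
    where
    open ≤-Reasoning
    d : ℕ
    d = depth G₀ ⊔ depth G₁
    below : ∀ G → depth G ≤ d → length (nodes G) < 2 ^ d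
    below G d≤ = <-≤-trans (length-nodes G) (^-monoʳ-≤ 2 d≤)

  length-vars : ∀ {c} G → All (λ x → arity (symOf σ x) ≤ c) (nodes G) →
    length (vars G) ≤ 2 ^ depth G * suc c
  length-vars {c} G arities = begin
    length (vars G)           ≤⟨ length-concatMap≤ indices (All.map (λ {x} → indices≤ x) arities) ⟩
    length (nodes G) * suc c  ≤⟨ *-monoˡ-≤ (suc c) (<⇒≤ (length-nodes G)) ⟩
    2 ^ depth G * suc c       ∎
    where
    open ≤-Reasoning
    indices≤ : ∀ x → arity (symOf σ x) ≤ c → length (indices x) ≤ suc c
    indices≤ x arity≤c = ≤-trans (length-indices x) (s≤s arity≤c)

  branches : List (Tree σ) → Expr σ → List (Tree σ)
  branches Gs (fe e) = L.map (fnode e) Gs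
  branches Gs (pe e) = cartesianProductWith (pnode e) Gs Gs

  trees : List (Expr σ) → List ℕ → ℕ → List (Tree σ)
  trees Es Ls zero = L.map leaf Ls
  trees Es Ls (suc d) = L.map leaf Ls ++ concatMap (branches (trees Es Ls d)) Es

  ∈-trees : ∀ {Es Ls} d G → nodes G ⊆ Es → leaves G ⊆ Ls → depth G ≤ d →
    G ∈ trees Es Ls d
  ∈-trees zero (leaf t) _ t∈ _ = ∈-map⁺ leaf (t∈ (here refl))
  ∈-trees (suc d) (leaf t) _ t∈ _ = ∈-++⁺ˡ (∈-map⁺ leaf (t∈ (here refl)))
  ∈-trees {Es} {Ls} (suc d) (fnode e G) E L (s≤s d≤) =
    ∈-++⁺ʳ _ (∈-concatMap⁺ (branches _) (lose (E (here refl)) (∈-map⁺ (fnode e) G∈)))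
    where
    G∈ : G ∈ trees Es Ls d
    G∈ = ∈-trees d G (E ∘ there) L d≤
  ∈-trees {Es} {Ls} (suc d) (pnode e G₀ G₁) E L (s≤s d≤) =
    ∈-++⁺ʳ _ (∈-concatMap⁺ (branches _)
      (lose (E (here refl)) (∈-cartesianProductWith⁺ (pnode e) G₀∈ G₁∈)))
    where
    G₀∈ : G₀ ∈ trees Es Ls d
    G₀∈ = ∈-trees d G₀ (E ∘ there ∘ ∈-++⁺ˡ) (L ∘ ∈-++⁺ˡ) (m⊔n≤o⇒m≤o _ _ d≤)
    G₁∈ : G₁ ∈ trees Es Ls d
    G₁∈ = ∈-trees d G₁ (E ∘ there ∘ ∈-++⁺ʳ (nodes G₀)) (L ∘ ∈-++⁺ʳ (leaves G₀))
                  (m⊔n≤o⇒n≤o _ _ d≤)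

  -- Indexing by the proof of kind f ≡ k lets ∈-expressionsOf reuse the proof stored in an
  -- expression, so no appeal to uniqueness of identity proofs is needed.
  expressionsWith : ℕ → (f : Sym) (k : Kind) → kind f ≡ k → List (Expr σ)
  expressionsWith N f func p = cartesianProductWith
    (λ j as → fe (record { j = j ; f = f ; isF = p ; args = as }))
    (upTo N) (vectors (upTo N) (arity f))
  expressionsWith N f pred p = L.map
    (λ as → pe (record { r = f ; isP = p ; args = as }))
    (vectors (upTo N) (arity f))

  expressionsOf : ℕ → Sym → List (Expr σ)
  expressionsOf N f = expressionsWith N f (kind f) refl

  expressionsOf≡expressionsWith : ∀ N f {k} (p : kind f ≡ k) →
    expressionsOf N f ≡ expressionsWith N f k p
  expressionsOf≡expressionsWith N f refl = refl

  ∈-expressionsOf : ∀ {N} x → All (_< N) (indices x) → x ∈ expressionsOf N (symOf σ x)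
  ∈-expressionsOf {N} (fe e) (j< ∷ args<) =
    subst (fe e ∈_) (sym (expressionsOf≡expressionsWith N (FExpr.f e) (FExpr.isF e)))
      (∈-cartesianProductWith⁺ _ (∈-upTo⁺ j<) (∈-vectors⁺ (All.map ∈-upTo⁺ args<)))
  ∈-expressionsOf {N} (pe e) args< =
    subst (pe e ∈_) (sym (expressionsOf≡expressionsWith N (PExpr.r e) (PExpr.isP e)))
      (∈-map⁺ _ (∈-vectors⁺ (All.map ∈-upTo⁺ args<)))

  expressions : ℕ → List Sym → List (Expr σ)
  expressions N Ss = concatMap (expressionsOf N) Ss

  ∈-expressions : ∀ {N Ss} x → symOf σ x ∈ Ss → All (_< N) (indices x) →
    x ∈ expressions N Ss
  ∈-expressions x f∈ idx< = ∈-concatMap⁺ _ (lose f∈ (∈-expressionsOf x idx<))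

  renameF : (ℕ → ℕ) → FExpr σ → FExpr σ
  renameF h e = record e { j = h (FExpr.j e) ; args = V.map h (FExpr.args e) }

  renameP : (ℕ → ℕ) → PExpr σ → PExpr σ
  renameP h e = record e { args = V.map h (PExpr.args e) }

  renameExpr : (ℕ → ℕ) → Expr σ → Expr σ
  renameExpr h (fe e) = fe (renameF h e)
  renameExpr h (pe e) = pe (renameP h e)

  rename : (ℕ → ℕ) → (ℕ → ℕ) → Tree σ → Tree σ
  rename h g (leaf t) = leaf (g t)
  rename h g (fnode e G) = fnode (renameF h e) (rename h g G)
  rename h g (pnode e G₀ G₁) = pnode (renameP h e) (rename h g G₀) (rename h g G₁)

  indices-renameExpr : ∀ h x → indices (renameExpr h x) ≡ L.map h (indices x)
  indices-renameExpr h (fe e) = cong (h (FExpr.j e) ∷_) (toList-map h (FExpr.args e))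
  indices-renameExpr h (pe e) = toList-map h (PExpr.args e)

  nodes-rename : ∀ h g G → nodes (rename h g G) ≡ L.map (renameExpr h) (nodes G)
  nodes-rename h g (leaf _) = refl
  nodes-rename h g (fnode e G) = cong (fe (renameF h e) ∷_) (nodes-rename h g G)
  nodes-rename h g (pnode e G₀ G₁) = cong (pe (renameP h e) ∷_) (begin
    nodes (rename h g G₀) ++ nodes (rename h g G₁)
      ≡⟨ cong₂ _++_ (nodes-rename h g G₀) (nodes-rename h g G₁) ⟩
    L.map (renameExpr h) (nodes G₀) ++ L.map (renameExpr h) (nodes G₁)
      ≡⟨ map-++ (renameExpr h) (nodes G₀) (nodes G₁) ⟨
    L.map (renameExpr h) (nodes G₀ ++ nodes G₁) ∎)
    where open ≡-Reasoning

  leaves-rename : ∀ h g G → leaves (rename h g G) ≡ L.map g (leaves G)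
  leaves-rename h g (leaf _) = refl
  leaves-rename h g (fnode _ G) = leaves-rename h g G
  leaves-rename h g (pnode _ G₀ G₁) =
    trans (cong₂ _++_ (leaves-rename h g G₀) (leaves-rename h g G₁))
          (sym (map-++ g (leaves G₀) (leaves G₁)))

  pathWords-rename : ∀ h g G → pathWords σ (rename h g G) ≡ pathWords σ G
  pathWords-rename h g (leaf _) = refl
  pathWords-rename h g (fnode e G) = cong (L.map (FExpr.f e ∷_)) (pathWords-rename h g G)
  pathWords-rename h g (pnode e G₀ G₁) = cong (L.map (PExpr.r e ∷_))
    (cong₂ _++_ (pathWords-rename h g G₀) (pathWords-rename h g G₁))

  module _ (U : Structure σ) (v : ℕ → Structure.A U)
           {h : ℕ → ℕ} {Us : List ℕ} (h-inj : InjectiveOn h Us) where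
    open ≡-Reasoning

    map-rename : ∀ {k} (as : Vec ℕ k) {M M' : TermSeq σ} →
      V.toList as ⊆ Us → AgreeOn Us (M' ∘ h) M → V.map M' (V.map h as) ≡ V.map M as
    map-rename as as⊆ agree = trans (sym (map-∘ _ h as)) (map-agreeOn as agree as⊆)

    stepF-rename : ∀ e {M M'} → indices (fe e) ⊆ Us → AgreeOn Us (M' ∘ h) M →
      AgreeOn Us (stepF σ M' (renameF h e) ∘ h) (stepF σ M e)
    stepF-rename record { j = j ; f = f ; isF = p ; args = as } {M} {M'} idx⊆ agree {i} i∈ =
      begin
      (if h i ≡ᵇ h j then t' else M' (h i))  ≡⟨ cong (if_then t' else M' (h i)) ≡ᵇ-preserved ⟩
      (if i ≡ᵇ j then t' else M' (h i))      ≡⟨ cong₂ (if i ≡ᵇ j then_else_) (cong (app f p) as')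
                                                                         (agree i∈) ⟩
      (if i ≡ᵇ j then app f p (V.map M as) else M i) ∎
      where
      t' : Term σ
      t' = app f p (V.map M' (V.map h as))
      as' : V.map M' (V.map h as) ≡ V.map M as
      as' = map-rename as (idx⊆ ∘ there) agree
      ≡ᵇ-preserved : (h i ≡ᵇ h j) ≡ (i ≡ᵇ j)
      ≡ᵇ-preserved = does-⇔ (mk⇔ (h-inj i∈ (idx⊆ (here refl))) (cong h)) (h i ≟ h j) (i ≟ j)

    κ-rename : ∀ e {M M'} → indices (pe e) ⊆ Us → AgreeOn Us (M' ∘ h) M →
      κ σ M' (renameP h e) ≡ κ σ M e
    κ-rename e idx⊆ agree =
      cong (atom (PExpr.r e) (PExpr.isP e)) (map-rename (PExpr.args e) idx⊆ agree)

    runTree-rename : ∀ g G {M M'} → All (λ x → indices x ⊆ Us) (nodes G) →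
      AgreeOn Us (M' ∘ h) M → runTree σ U v M' (rename h g G) ≡ g (runTree σ U v M G)
    runTree-rename g (leaf t) _ _ = refl
    runTree-rename g (fnode e G) (idx⊆ ∷ idxs⊆) agree =
      runTree-rename g G idxs⊆ (stepF-rename e idx⊆ agree)
    runTree-rename g (pnode e G₀ G₁) {M} {M'} (idx⊆ ∷ idxs⊆) agree = begin
      (if atomVal σ U v (κ σ M' (renameP h e)) then R₁' else R₀')
        ≡⟨ cong (λ φ → if atomVal σ U v φ then R₁' else R₀') (κ-rename e idx⊆ agree) ⟩
      (if b then R₁' else R₀')
        ≡⟨ cong₂ (if b then_else_) (runTree-rename g G₁ (++⁻ʳ (nodes G₀) idxs⊆) agree)
                                   (runTree-rename g G₀ (++⁻ˡ (nodes G₀) idxs⊆) agree) ⟩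
      (if b then g (runTree σ U v M G₁) else g (runTree σ U v M G₀))
        ≡⟨ if-float g b ⟨
      g (if b then runTree σ U v M G₁ else runTree σ U v M G₀) ∎
      where
      b : Bool
      b = atomVal σ U v (κ σ M e)
      R₀' R₁' : ℕ
      R₀' = runTree σ U v M' (rename h g G₀)
      R₁' = runTree σ U v M' (rename h g G₁)

  module _ (U : Structure σ) {v w : ℕ → Structure.A U} (v≗w : v ≗ w) where
    mutual
      evalT-cong : ∀ t → evalT σ U v t ≡ evalT σ U w t
      evalT-cong (var x) = v≗w x
      evalT-cong (app f p ts) = cong (Structure.fun U f p) (evalTs-cong ts)

      evalTs-cong : ∀ {k} (ts : Vec (Term σ) k) → evalTs σ U v ts ≡ evalTs σ U w ts
      evalTs-cong [] = refl
      evalTs-cong (t ∷ ts) = cong₂ _∷_ (evalT-cong t) (evalTs-cong ts)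

    evalExprs-cong : ∀ M es → evalExprs σ U v M es ≡ evalExprs σ U w M es
    evalExprs-cong M [] = refl
    evalExprs-cong M (fe e ∷ es) = evalExprs-cong (stepF σ M e) es
    evalExprs-cong M (pe e ∷ es) = cong₂ _∷_
      (cong (Structure.rel U (PExpr.r e) (PExpr.isP e)) (evalTs-cong (V.map M (PExpr.args e))))
      (evalExprs-cong M es)

  env-cong : ∀ U n {ā b̄ : Fin n → Structure.A U} → ā ≗ b̄ → env σ U n ā ≗ env σ U n b̄
  env-cong U n ā≗b̄ i with i <? n
  ... | yes i<n = ā≗b̄ (fromℕ< i<n)
  ... | no _ = refl

  φP-cong : ∀ s U {ā b̄} → ā ≗ b̄ → φP σ s U ā ≡ φP σ s U b̄
  φP-cong s U ā≗b̄ = cong ν (evalExprs-cong U (env-cong U n ā≗b̄) (M₁ σ n) exprs)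
    where open ProblemScheme s

  decisionTree : (es : List (Expr σ)) → (Vec Bool (npred σ es) → ℕ) → Tree σ
  decisionTree [] k = leaf (k [])
  decisionTree (fe e ∷ es) k = fnode e (decisionTree es k)
  decisionTree (pe e ∷ es) k =
    pnode e (decisionTree es (k ∘ (false ∷_))) (decisionTree es (k ∘ (true ∷_)))

  runTree-decisionTree : ∀ U v M es k →
    runTree σ U v M (decisionTree es k) ≡ k (evalExprs σ U v M es)
  runTree-decisionTree U v M [] k = refl
  runTree-decisionTree U v M (fe e ∷ es) k = runTree-decisionTree U v (stepF σ M e) es k
  runTree-decisionTree U v M (pe e ∷ es) k with atomVal σ U v (κ σ M e)
  ... | true = runTree-decisionTree U v M es (k ∘ (true ∷_))
  ... | false = runTree-decisionTree U v M es (k ∘ (false ∷_))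

  treeScheme : ProblemScheme σ → Tree σ → TreeScheme σ
  treeScheme s G = record { n = ProblemScheme.n s ; n≥1 = ProblemScheme.n≥1 s ; G = G }

  decisionScheme : ProblemScheme σ → TreeScheme σ
  decisionScheme s = treeScheme s (decisionTree (ProblemScheme.exprs s) (ProblemScheme.ν s))

  decisionScheme-solves : ∀ D s → Solves σ D (decisionScheme s) s
  decisionScheme-solves D s = refl , inj₂ λ U _ ā →
    trans (runTree-decisionTree U (env σ U n ā) (M₁ σ n) exprs ν)
          (φP-cong s U (λ i → cong ā (sym (cast-is-id _ i))))
    where open ProblemScheme s

  solves-treeScheme : ∀ {D} S s → Solves σ D S s →
    Solves σ D (treeScheme s (TreeScheme.G S)) s
  solves-treeScheme _ _ (refl , solution) = refl , solution

  solves-map : ∀ {D s G G'} (g : ℕ → ℕ) →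
    (∀ U ā → φT σ (treeScheme s G') U ā ≡ g (φT σ (treeScheme s G) U ā)) →
    (∀ U ā → g (φP σ s U ā) ≡ φP σ s U ā) →
    Solves σ D (treeScheme s G) s → Solves σ D (treeScheme s G') s
  solves-map g _ _ (eq , inj₁ no-structure) = eq , inj₁ no-structure
  solves-map g φT' g-fixes (eq , inj₂ agree) =
    eq , inj₂ λ U DU ā → trans (φT' U ā) (trans (cong g (agree U DU ā)) (g-fixes U _))

module Complexity (σ : Signature) (ψ : Word σ → ℕ) where
  open Signature σ
  open Schemes σ

  complexity : Tree σ → ℕ
  complexity G = maxBy ψ (pathWords σ G)

  module _ (K-total : KTotalRecursive σ ψ) where
    private
      K = proj₁ K-total
      enum = proj₂ K-total

    symbolsOfComplexity : ℕ → List Sym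
    symbolsOfComplexity i = L.map (proj₁ ∘ Inverse.to (enum i)) (allFin (K i))

    ∈-symbolsOfComplexity : ∀ q → q ∈ symbolsOfComplexity (ψ [ q ])
    ∈-symbolsOfComplexity q = subst (_∈ symbolsOfComplexity (ψ [ q ]))
      (cong proj₁ (Inverse.strictlyInverseˡ (enum (ψ [ q ])) (q , refl)))
      (∈-map⁺ (proj₁ ∘ Inverse.to (enum (ψ [ q ]))) (∈-allFin _))

    symbolsUpTo : ℕ → List Sym
    symbolsUpTo b = concatMap symbolsOfComplexity (upTo (suc b))

    ∈-symbolsUpTo : ∀ {b q} → ψ [ q ] ≤ b → q ∈ symbolsUpTo b
    ∈-symbolsUpTo {q = q} ψq≤b =
      ∈-concatMap⁺ symbolsOfComplexity (lose (∈-upTo⁺ (s≤s ψq≤b)) (∈-symbolsOfComplexity q))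

  module _ (ψ-strict : StrictlyLimited σ ψ) where

    ψ[w]<ψ[q∷w] : ∀ q w → ψ w < ψ (q ∷ w)
    ψ[w]<ψ[q∷w] q w = ψ-strict [] [ q ] w (λ ())

    ψ[q]≤ψ[q∷w] : ∀ q w → ψ [ q ] ≤ ψ (q ∷ w)
    ψ[q]≤ψ[q∷w] q [] = ≤-refl
    ψ[q]≤ψ[q∷w] q w@(_ ∷ _) =
      <⇒≤ (subst (λ u → ψ [ q ] < ψ (q ∷ u)) (++-identityʳ w) (ψ-strict [ q ] w [] (λ ())))

    somePath : ∀ G → ∃ λ w → w ∈ pathWords σ G
    somePath (leaf _) = [] , here refl
    somePath (fnode e G) with w , w∈ ← somePath G = FExpr.f e ∷ w , ∈-map⁺ _ w∈
    somePath (pnode e G₀ G₁) with w , w∈ ← somePath G₀ =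
      PExpr.r e ∷ w , ∈-map⁺ _ (∈-++⁺ˡ w∈)

    complexity-< : ∀ q G G' → (∀ {w} → w ∈ pathWords σ G → q ∷ w ∈ pathWords σ G') →
      complexity G < complexity G'
    complexity-< q G G' extend
      with w , w∈ , max≤ψw ← maxBy-attained ψ (proj₂ (somePath G)) = begin-strict
      complexity G   ≤⟨ max≤ψw ⟩
      ψ w            <⟨ ψ[w]<ψ[q∷w] q w ⟩
      ψ (q ∷ w)      ≤⟨ ≤-maxBy ψ (extend w∈) ⟩
      complexity G'  ∎
      where open ≤-Reasoning

    complexity-fnode : ∀ e G → complexity G < complexity (fnode e G)
    complexity-fnode e G = complexity-< (FExpr.f e) G (fnode e G) (∈-map⁺ _)

    complexity-pnode₀ : ∀ e G₀ G₁ → complexity G₀ < complexity (pnode e G₀ G₁)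
    complexity-pnode₀ e G₀ G₁ =
      complexity-< (PExpr.r e) G₀ (pnode e G₀ G₁) (∈-map⁺ _ ∘ ∈-++⁺ˡ)

    complexity-pnode₁ : ∀ e G₀ G₁ → complexity G₁ < complexity (pnode e G₀ G₁)
    complexity-pnode₁ e G₀ G₁ =
      complexity-< (PExpr.r e) G₁ (pnode e G₀ G₁) (∈-map⁺ _ ∘ ∈-++⁺ʳ (pathWords σ G₀))

    ψ-root≤complexity : ∀ {q} G w → q ∷ w ∈ pathWords σ G → ψ [ q ] ≤ complexity G
    ψ-root≤complexity {q} G w q∷w∈ = ≤-trans (ψ[q]≤ψ[q∷w] q w) (≤-maxBy ψ q∷w∈)

    depth≤complexity : ∀ G → depth G ≤ complexity G
    depth≤complexity (leaf _) = z≤n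
    depth≤complexity (fnode e G) = ≤-<-trans (depth≤complexity G) (complexity-fnode e G)
    depth≤complexity (pnode e G₀ G₁) = ⊔-lub
      (≤-<-trans (depth≤complexity G₀) (complexity-pnode₀ e G₀ G₁))
      (≤-<-trans (depth≤complexity G₁) (complexity-pnode₁ e G₀ G₁))

    symbols-bounded : ∀ {b} G → complexity G ≤ b → All (λ x → ψ [ symOf σ x ] ≤ b) (nodes G)
    symbols-bounded (leaf _) _ = []
    symbols-bounded (fnode e G) G≤b with w , w∈ ← somePath G =
      ≤-trans (ψ-root≤complexity (fnode e G) w (∈-map⁺ _ w∈)) G≤b
      ∷ symbols-bounded G (≤-trans (<⇒≤ (complexity-fnode e G)) G≤b)
    symbols-bounded (pnode e G₀ G₁) G≤b with w , w∈ ← somePath G₀ =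
      ≤-trans (ψ-root≤complexity (pnode e G₀ G₁) w (∈-map⁺ _ (∈-++⁺ˡ w∈))) G≤b
      ∷ ++⁺ (symbols-bounded G₀ (≤-trans (<⇒≤ (complexity-pnode₀ e G₀ G₁)) G≤b))
            (symbols-bounded G₁ (≤-trans (<⇒≤ (complexity-pnode₁ e G₀ G₁)) G≤b))

module Normalisation (σ : Signature) (ψ : Word σ → ℕ) (ψ-strict : StrictlyLimited σ ψ)
                     (K-total : KTotalRecursive σ ψ) (s : ProblemScheme σ) where
  open Signature σ
  open Schemes σ
  open Complexity σ ψ
  open ProblemScheme s

  values : List ℕ
  values = L.map ν (vectors (false ∷ true ∷ []) (npred σ exprs))

  ν∈values : ∀ bs → ν bs ∈ values
  ν∈values bs = ∈-map⁺ ν (∈-vectors⁺ (All.tabulate bool∈))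
    where
    bool∈ : ∀ {b} → b ∈ V.toList bs → b ∈ false ∷ true ∷ []
    bool∈ {false} _ = here refl
    bool∈ {true} _ = there (here refl)

  -- A tree solving s reaches only leaves labelled by values of ν, which toValue fixes.
  toValue : ℕ → ℕ
  toValue = retract values (ν (V.replicate _ false))

  -- M₁ n reads x_i as x_(i ⊓ (n ∸ 1)), so the indices below n ∸ 1 must stay fixed, while the
  -- others only need to stay distinct and at least n ∸ 1.
  normalise : Tree σ → Tree σ
  normalise G = rename (packAbove (n ∸ 1) (vars G)) toValue G

  complexity-normalise : ∀ G → complexity (normalise G) ≡ complexity G
  complexity-normalise G = cong (maxBy ψ) (pathWords-rename _ _ G)

  normalise-solves : ∀ {D} G → Solves σ D (treeScheme s G) s →
    Solves σ D (treeScheme s (normalise G)) s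
  normalise-solves G = solves-map {s = s} {G} {normalise G} toValue
    (λ U ā → runTree-rename U (env σ U n ā) (packAbove-injective (n ∸ 1) (vars G)) toValue G
               (indices⊆vars G) (λ {i} _ → cong var (packAbove-⊓ (n ∸ 1) (vars G) i)))
    (λ U ā → retract-id (ν∈values _))

  bound : ℕ
  bound = complexity (decisionTree exprs ν)

  symbols : List Sym
  symbols = symbolsUpTo K-total bound

  width : ℕ
  width = (n ∸ 1) + 2 ^ bound * suc (maxBy arity symbols)

  candidates : List (Tree σ)
  candidates = trees (expressions width symbols) values bound

  module _ {G : Tree σ} (G≤bound : complexity G ≤ bound) where

    length-vars-bounded : length (vars G) ≤ 2 ^ bound * suc (maxBy arity symbols)
    length-vars-bounded =
      ≤-trans (length-vars G arities) (*-monoˡ-≤ _ (^-monoʳ-≤ 2 depth≤bound))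
      where
      arities : All (λ x → arity (symOf σ x) ≤ maxBy arity symbols) (nodes G)
      arities = All.map (≤-maxBy arity ∘ ∈-symbolsUpTo K-total)
                        (symbols-bounded ψ-strict G G≤bound)
      depth≤bound : depth G ≤ bound
      depth≤bound = ≤-trans (depth≤complexity ψ-strict G) G≤bound

    indices-normalise : ∀ {x} → x ∈ nodes (normalise G) → All (_< width) (indices x)
    indices-normalise x∈
      with y , y∈ , refl ← ∈-map⁻ _ (subst (_ ∈_) (nodes-rename _ toValue G) x∈) =
      subst (All (_< width)) (sym (indices-renameExpr _ y)) (All.map⁺ (All.tabulate packed<))
      where
      packed< : ∀ {i} → i ∈ indices y → packAbove (n ∸ 1) (vars G) i < width
      packed< i∈ = <-≤-trans (packAbove-< (n ∸ 1) (All.lookup (indices⊆vars G) y∈ i∈))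
                             (+-monoʳ-≤ (n ∸ 1) length-vars-bounded)

    leaves-normalise : leaves (normalise G) ⊆ values
    leaves-normalise t∈
      with t₀ , _ , refl ← ∈-map⁻ _ (subst (_ ∈_) (leaves-rename _ toValue G) t∈) =
      retract-∈ (ν∈values _) t₀

    normalise∈candidates : normalise G ∈ candidates
    normalise∈candidates = ∈-trees bound (normalise G) nodes-normalise leaves-normalise
      (≤-trans (depth≤complexity ψ-strict _) normalise≤bound)
      where
      normalise≤bound : complexity (normalise G) ≤ bound
      normalise≤bound = ≤-trans (≤-reflexive (complexity-normalise G)) G≤bound
      nodes-normalise : nodes (normalise G) ⊆ expressions width symbols
      nodes-normalise {x} x∈ = ∈-expressions x
        (∈-symbolsUpTo K-total (All.lookup (symbols-bounded ψ-strict _ normalise≤bound) x∈))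
        (indices-normalise x∈)

  normalise-dominates : ∀ {D} S → Solves σ D S s → ψT σ ψ S ≤ ψT σ ψ (decisionScheme s) →
    ∃ λ S' → S' ∈ L.map (treeScheme s) candidates × Solves σ D S' s × ψT σ ψ S' ≤ ψT σ ψ S
  normalise-dominates S S-solves S≤bound =
    treeScheme s (normalise G) , ∈-map⁺ _ (normalise∈candidates S≤bound) ,
    normalise-solves G (solves-treeScheme S s S-solves) , ≤-reflexive (complexity-normalise G)
    where
    G : Tree σ
    G = TreeScheme.G S

theorem5 : (σ : Signature) (ψ : Word σ → ℕ) →
    StrictlyLimited σ ψ → KTotalRecursive σ ψ →
    (C : Class σ) → Σ (Structure σ) C →
    (H : Formula σ → Set) → (∀ α → H α → Sentence σ α) → Σ (Formula σ) H →
    SolvabilityDecidable σ H C → OptimizationDecidable σ ψ H C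
theorem5 σ ψ ψ-strict K-total C _ _ _ _ solvable? α Hα s =
  optimum-from-candidates (λ S → Solves σ (_⟨_⟩ σ C α) S s) (solvable? α Hα s) (ψT σ ψ)
    (decisionScheme s) (decisionScheme-solves _ s)
    (L.map (treeScheme s) candidates) normalise-dominates
  where
  open Schemes σ
  open Normalisation σ ψ ψ-strict K-total s
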